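{- For every integer $n\ge 1$, the Fermat number $F_n=2^{2^{n-1}}+1$ is primover to base $2$.
   Context: For an integer $a>1$ and an odd integer $n>1$ with $\gcd(a,n)=1$: $h_a(n)$ denotes the multiplicative order of $a$ modulo $n$. A cyclotomic coset of $a$ modulo $n$ is a set of the form $\{\, s a^j \bmod n : j\ge 0\,\}$ with $s\in\{1,\dots,n-1\}$; these cosets partition $\{1,\dots,n-1\}$, and $r_a(n)$ denotes the number of distinct cyclotomic cosets of $a$ modulo $n$. An odd composite number $n$ coprime to $a$ is called an overpseudoprime to base $a$ if $n=r_a(n)\,h_a(n)+1$. An integer $N>1$ is called primover to base $a$ if it is either prime or an overpseudoprime to base $a$. -}

module Defs where

open import Data.Fin.Base using (Fin)
open import Data.Fin.Properties using (injective⇒≤)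
open import Data.Nat.Base using (ℕ; _+_; _*_; _∸_; _^_; _%_; _≤_; _<_; NonZero; NonTrivial)
open import Data.Nat.Coprimality using (Coprime)
open import Data.Nat.Divisibility using (_∤_)
open import Data.Nat.Primality using (Prime; Composite)
open import Data.Nat.Properties using (≤-antisym)
open import Data.Product.Base using (Σ-syntax; ∃-syntax; _×_; _,_; proj₁; proj₂)
open import Data.Sum.Base using (_⊎_)
open import Function.Bundles using (Bijection)
open import Level using (0ℓ)
open import Relation.Binary.Bundles using (Setoid)
import Relation.Binary.Construct.On as On
open import Relation.Binary.PropositionalEquality using (_≡_; refl; setoid)
open import Relation.Unary using (Pred)
open import Relation.Unary.Relation.Binary.Equality using (≐-setoid)

record IsMultiplicativeOrder (a n h : ℕ) .{{_ : NonZero n}} : Set where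
  field
    positive : 0 < h
    power≡1  : (a ^ h) % n ≡ 1 % n
    minimal  : ∀ k → 0 < k → (a ^ k) % n ≡ 1 % n → h ≤ k

cyclotomicCoset : (a n s : ℕ) .{{_ : NonZero n}} → Pred ℕ 0ℓ
cyclotomicCoset a n s x = ∃[ j ] x ≡ (s * a ^ j) % n

-- The collection of all cyclotomic cosets of a modulo n. Elements are given by
-- a representative s ∈ {1,…,n-1}; two of them are equal exactly when their
-- cosets are equal as sets (mutual inclusion), not when the representatives
-- agree.
cyclotomicCosets : (a n : ℕ) .{{_ : NonZero n}} → Setoid 0ℓ 0ℓ
cyclotomicCosets a n = On.setoid {B = Σ[ s ∈ ℕ ] 1 ≤ s × s < n}
  (≐-setoid ℕ 0ℓ) (λ rep → cyclotomicCoset a n (proj₁ rep))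

IsCyclotomicCosetCount : (a n r : ℕ) .{{_ : NonZero n}} → Set
IsCyclotomicCosetCount a n r = Bijection (setoid (Fin r)) (cyclotomicCosets a n)

-- The numbers h_a(n) and r_a(n) enter through their defining properties; both
-- are unique (see the two lemmas at the end), so it does not matter whether
-- they are quantified existentially or universally once they exist.
record Overpseudoprime (a n : ℕ) .{{_ : NonTrivial a}} : Set where
  field
    .{{nonZero}} : NonZero n
    odd          : 2 ∤ n
    isComposite  : Composite n
    coprime      : Coprime a n
    h            : ℕ
    r            : ℕ
    h-order      : IsMultiplicativeOrder a n h
    r-count      : IsCyclotomicCosetCount a n r
    n≡rh+1       : n ≡ r * h + 1

Primover : (a N : ℕ) .{{_ : NonTrivial a}} → Set
Primover a N = 1 < N × (Prime N ⊎ Overpseudoprime a N)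

-- Indexed so that fermat 1 = 3, fermat 2 = 5, fermat 3 = 17; only n ≥ 1 is
-- meaningful.
fermat : ℕ → ℕ
fermat n = 2 ^ (2 ^ (n ∸ 1)) + 1

multiplicativeOrder-unique : ∀ {a n h h′} .{{_ : NonZero n}} →
  IsMultiplicativeOrder a n h → IsMultiplicativeOrder a n h′ → h ≡ h′
multiplicativeOrder-unique p q = ≤-antisym
  (P.minimal _ Q.positive Q.power≡1) (Q.minimal _ P.positive P.power≡1)
  where
  module P = IsMultiplicativeOrder p
  module Q = IsMultiplicativeOrder q

cyclotomicCosetCount-unique : ∀ {a n r r′} .{{_ : NonZero n}} →
  IsCyclotomicCosetCount a n r → IsCyclotomicCosetCount a n r′ → r ≡ r′
cyclotomicCosetCount-unique {a} {n} p q = ≤-antisym (bound p q) (bound q p)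
  where
  open Setoid (cyclotomicCosets a n) using (_≈_)
    renaming (sym to ≈-sym; trans to ≈-trans)
  bound : ∀ {r r′} → IsCyclotomicCosetCount a n r →
          IsCyclotomicCosetCount a n r′ → r ≤ r′
  bound {r} {r′} p q = injective⇒≤ {f = f} f-injective
    where
    module P = Bijection p
    module Q = Bijection q
    f : Fin r → Fin r′
    f i = proj₁ (Q.surjective (P.to i))
    f-spec : ∀ i → Q.to (f i) ≈ P.to i
    f-spec i = proj₂ (Q.surjective (P.to i)) refl
    f-injective : ∀ {i j} → f i ≡ f j → i ≡ j
    f-injective {i} {j} fi≡fj = P.injective
      (≈-trans {P.to i} {Q.to (f i)} {P.to j} (≈-sym {Q.to (f i)} {P.to i} (f-spec i))
        (≈-trans {Q.to (f i)} {Q.to (f j)} {P.to j} (Q.cong fi≡fj) (f-spec j)))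

{-# OPTIONS --safe #-}
-- Put M = 2^(2^m), N = M + 1 and h = 2^(m+1), so that M ≡ -1 and 2^h ≡ 1 mod N.
-- Multiplication by 2 has no orbit of length less than h on {1,…,N-1}: if
-- 0 < k < h and s 2^k ≡ s, then some multiple of k is an odd multiple of 2^m, so
-- s ≡ s 2^(2^m (2t+1)) ≡ -s, whence N ∣ 2s and N ∣ s. Thus every cyclotomic coset
-- has exactly h elements, and the N - 1 nonzero residues fall into (N - 1) / h of
-- them. Taking s = 1 shows that h is the order of 2.
module Submission where

open import Defs
open import Data.Fin.Base using (Fin; zero; suc; toℕ; fromℕ<)
open import Data.Fin.Properties using (toℕ<n; toℕ-fromℕ<)
open import Data.List.Base using (List; []; _∷_; length; lookup; applyUpTo; concatMap; deduplicate; tabulate)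
open import Data.List.Membership.Propositional using (_∈_)
open import Data.List.Membership.DecPropositional using (_∈?_)
open import Data.List.Membership.Propositional.Properties using (∈-applyUpTo⁺; ∈-applyUpTo⁻; ∈-concatMap⁺; ∈-concatMap⁻; ∈-lookup)
open import Data.List.Membership.Propositional.Properties.WithK using (unique∧set⇒bag)
open import Data.List.Membership.Setoid.Properties using (∈-deduplicate⁺)
open import Data.List.Properties using (length-++; length-applyUpTo)
open import Data.List.Relation.Binary.BagAndSetEquality using (∼bag⇒↭)
open import Data.List.Relation.Binary.Disjoint.Propositional using (Disjoint)
open import Data.List.Relation.Binary.Permutation.Propositional.Properties using (↭-length)
import Data.List.Relation.Unary.All as All
import Data.List.Relation.Unary.All.Properties as All
open import Data.List.Relation.Unary.AllPairs using (_∷_)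
import Data.List.Relation.Unary.AllPairs as AllPairs
import Data.List.Relation.Unary.AllPairs.Properties as AllPairs
open import Data.List.Relation.Unary.Any using (Any; index; satisfied)
import Data.List.Relation.Unary.Any as Any
open import Data.List.Relation.Unary.Any.Properties using (lookup-index; tabulate⁺)
open import Data.List.Relation.Unary.Unique.DecSetoid.Properties using (deduplicate-!)
open import Data.List.Relation.Unary.Unique.Propositional using (Unique)
open import Data.List.Relation.Unary.Unique.Propositional.Properties using (applyUpTo⁺₁; concat⁺)
import Data.List.Relation.Unary.Unique.Setoid as SetoidUnique
open import Data.Nat.Base using (ℕ; zero; suc; pred; _+_; _*_; _∸_; _^_; _%_; _/_; _≤_; _<_; z≤n; s≤s; s≤s⁻¹; NonZero; ≢-nonZero; n>1⇒nonTrivial)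
open import Data.Nat.Coprimality using (Coprime; coprime-divisor)
import Data.Nat.Coprimality as Coprime
open import Data.Nat.Divisibility using (_∣_; _∤_; divides; ∣-trans; ∣m+n∣m⇒∣n; ∣1⇒≡1; m∣m*n; m%n≡0⇒n∣m; n∣m⇒m%n≡0)
open import Data.Nat.DivMod using (m≡m%n+[m/n]*n; m%n<n; m<n⇒m%n≡m; m%n%n≡m%n; %-distribˡ-*; %-distribˡ-+; [m+kn]%n≡m%n)
open import Data.Nat.Primality using (prime?; ¬prime⇒composite)
open import Data.Nat.Properties
open import Data.Nat.Tactic.RingSolver using (solve-∀)
open import Data.Product.Base using (∃-syntax; _,_; proj₁; proj₂)
open import Data.Sum.Base using (_⊎_; inj₁; inj₂)
open import Function.Bundles using (mk⇔)
open import Level using (0ℓ)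
open import Relation.Binary.Bundles using (Setoid; DecSetoid)
open import Relation.Binary.Definitions using (Decidable)
open import Relation.Binary.PropositionalEquality using (_≡_; _≢_; refl; sym; trans; cong; cong₂; subst; module ≡-Reasoning)
open import Relation.Nullary using (¬_; yes; no; contradiction)
open import Relation.Nullary.Decidable using (map′)

-- Positions and lengths in lists.

module _ {c ℓ} (S : Setoid c ℓ) where
  open Setoid S using (Carrier; _≈_) renaming (sym to ≈-sym)

  -- Stated for a setoid because it will index representatives that are distinct only up to equality
  -- of their cosets.
  lookup-injective : ∀ {xs : List Carrier} → SetoidUnique.Unique S xs →
    ∀ {i j} → lookup xs i ≈ lookup xs j → i ≡ j
  lookup-injective (_ ∷ _) {zero} {zero} _ = refl
  lookup-injective {_ ∷ _} (x∉ ∷ _) {zero} {suc j} eq =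
    contradiction eq (All.lookup x∉ (∈-lookup j))
  lookup-injective {_ ∷ _} (x∉ ∷ _) {suc i} {zero} eq =
    contradiction (≈-sym eq) (All.lookup x∉ (∈-lookup i))
  lookup-injective (_ ∷ u) {suc i} {suc j} eq = cong suc (lookup-injective u eq)

length-concatMap : ∀ {A B : Set} (f : A → List B) {h} → (∀ x → length (f x) ≡ h) →
  ∀ xs → length (concatMap f xs) ≡ length xs * h
length-concatMap f len []       = refl
length-concatMap f len (x ∷ xs) =
  trans (length-++ (f x)) (cong₂ _+_ (len x) (length-concatMap f len xs))

-- Congruence arithmetic modulo n.

module Congruence (n : ℕ) .{{_ : NonZero n}} where

  infix 4 _≋_
  _≋_ : ℕ → ℕ → Set
  x ≋ y = x % n ≡ y % n

  %-≋ : ∀ x → x % n ≋ x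
  %-≋ x = m%n%n≡m%n x n

  *-cong-≋ : ∀ {x x′ y y′} → x ≋ x′ → y ≋ y′ → x * y ≋ x′ * y′
  *-cong-≋ {x} {x′} {y} {y′} p q = trans (%-distribˡ-* x y n)
    (trans (cong₂ (λ u v → u * v % n) p q) (sym (%-distribˡ-* x′ y′ n)))

  *-congˡ-≋ : ∀ x {y y′} → y ≋ y′ → x * y ≋ x * y′
  *-congˡ-≋ x = *-cong-≋ {x} refl

  *-congʳ-≋ : ∀ y {x x′} → x ≋ x′ → x * y ≋ x′ * y
  *-congʳ-≋ y p = *-cong-≋ {y = y} p refl

  *-identityʳ-≋ : ∀ s {x} → x ≋ 1 → s * x ≋ s
  *-identityʳ-≋ s p = trans (*-congˡ-≋ s p) (cong (_% n) (*-identityʳ s))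

  -- The factor `s` may share divisors with `n`, so it cannot be cancelled to get `x ≋ 1`. Induction
  -- on the exponent keeps `s` in place throughout.
  fixed-^ : ∀ s x → s * x ≋ s → ∀ q → s * x ^ q ≋ s
  fixed-^ s x p zero    = cong (_% n) (*-identityʳ s)
  fixed-^ s x p (suc q) = trans (cong (_% n) (sym (*-assoc s x (x ^ q))))
    (trans (*-congʳ-≋ (x ^ q) p) (fixed-^ s x p q))

  1-^ : ∀ {x} → x ≋ 1 → ∀ q → x ^ q ≋ 1
  1-^ {x} p q = trans (cong (_% n) (sym (*-identityˡ (x ^ q))))
    (fixed-^ 1 x (trans (cong (_% n) (*-identityˡ x)) p) q)

-- Powers of a acting on residues.

-- The last hypothesis says that ⟨a⟩ ≅ ℤ/h acts freely on the nonzero residues.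
module FreeAction (a n h : ℕ) .{{_ : NonZero n}} .{{_ : NonZero h}}
  (a^h≋1 : (a ^ h) % n ≡ 1 % n)
  (free  : ∀ s k → 1 ≤ s → s < n → 0 < k → k < h → (s * a ^ k) % n ≢ s % n)
  where

  open Congruence n

  act : ℕ → ℕ → ℕ
  act s j = (s * a ^ j) % n

  act< : ∀ s j → act s j < n
  act< s j = m%n<n (s * a ^ j) n

  act-≋ : ∀ s j → act s j ≋ s * a ^ j
  act-≋ s j = %-≋ (s * a ^ j)

  act-+ : ∀ s i j → act (act s i) j ≡ act s (i + j)
  act-+ s i j = trans (*-congʳ-≋ (a ^ j) (act-≋ s i)) (cong (_% n)
    (trans (*-assoc s (a ^ i) (a ^ j)) (cong (s *_) (sym (^-distribˡ-+-* a i j)))))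

  a^hq≋1 : ∀ q → a ^ (h * q) ≋ 1
  a^hq≋1 q = trans (cong (_% n) (sym (^-*-assoc a h q))) (1-^ a^h≋1 q)

  act-hq : ∀ s q → act s (h * q) ≡ s % n
  act-hq s q = *-identityʳ-≋ s (a^hq≋1 q)

  -- Plays the role of `-j` modulo `h`: adding it to `j` gives a multiple of `h`, so the action can
  -- be undone without negative exponents.
  opposite : ℕ → ℕ
  opposite j = pred h * j

  j+opposite : ∀ j → j + opposite j ≡ h * j
  j+opposite j = cong (_* j) (suc-pred h)

  act-inverse : ∀ s j → act (act s j) (opposite j) ≡ s % n
  act-inverse s j = trans (act-+ s j (opposite j))
    (trans (cong (act s) (j+opposite j)) (act-hq s j))

  -- Cosets allow arbitrary exponents; this reduction lets a list of `h` entries exhaust them.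
  act-mod : ∀ s j → act s j ≡ act s (j % h)
  act-mod s j = trans (cong (act s) eq) (trans (sym (act-+ s (h * (j / h)) (j % h)))
    (*-congʳ-≋ (a ^ (j % h)) (trans (cong (_% n) (act-hq s (j / h))) (%-≋ s))))
    where
    eq : j ≡ h * (j / h) + j % h
    eq = trans (m≡m%n+[m/n]*n j h) (trans (+-comm (j % h) _) (cong (_+ j % h) (*-comm (j / h) h)))

  -- Undoing the action sends 0 to 0, so a zero value would force `s` itself to be 0.
  1≤act : ∀ s j → 1 ≤ s → s < n → 1 ≤ act s j
  1≤act s j 1≤s s<n = n≢0⇒n>0 λ act≡0 → n>0⇒n≢0 1≤s
    (trans (sym (m<n⇒m%n≡m s<n)) (trans (sym (act-inverse s j))
      (trans (cong (λ u → act u (opposite j)) act≡0) (m<n⇒m%n≡m (≤-<-trans z≤n s<n)))))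

  act-distinct : ∀ s {i j} → 1 ≤ s → s < n → i < j → j < h → act s i ≢ act s j
  act-distinct s {i} {j} 1≤s s<n i<j j<h eq =
    free s (j ∸ i) 1≤s s<n (m<n⇒0<n∸m i<j) (≤-<-trans (m∸n≤m j i) j<h) (begin
      -- The extra reduction modulo `n` matches the reduced value that `act-inverse` returns.
      act s (j ∸ i)                                ≡⟨ m%n%n≡m%n (s * a ^ (j ∸ i)) n ⟨
      act s (j ∸ i) % n                            ≡⟨ act-inverse (act s (j ∸ i)) i ⟨
      act (act (act s (j ∸ i)) i) (opposite i)     ≡⟨ cong (λ u → act u (opposite i)) (act-+ s (j ∸ i) i) ⟩
      act (act s (j ∸ i + i)) (opposite i)         ≡⟨ cong (λ u → act (act s u) (opposite i)) (m∸n+n≡m (<⇒≤ i<j)) ⟩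
      act (act s j) (opposite i)                   ≡⟨ cong (λ u → act u (opposite i)) eq ⟨
      act (act s i) (opposite i)                   ≡⟨ act-inverse s i ⟩
      s % n                                        ∎)
    where open ≡-Reasoning

  -- Cosets as finite orbits.

  open Setoid (cyclotomicCosets a n) using (_≈_)
    renaming (Carrier to Rep; isEquivalence to ≈-isEquivalence; refl to ≈-refl; sym to ≈-sym; trans to ≈-trans)

  coset-self : ∀ {s} → s < n → cyclotomicCoset a n s s
  coset-self {s} s<n = 0 , sym (trans (cong (_% n) (*-identityʳ s)) (m<n⇒m%n≡m s<n))

  coset-sym : ∀ {s t} → t < n → cyclotomicCoset a n t s → cyclotomicCoset a n s t
  coset-sym {s} {t} t<n (j , refl) = opposite j , sym (trans (act-inverse t j) (m<n⇒m%n≡m t<n))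

  coset-trans : ∀ s t u → cyclotomicCoset a n t s →
    cyclotomicCoset a n u t → cyclotomicCoset a n u s
  coset-trans _ _ u (j , refl) (i , refl) = i + j , act-+ u i j

  -- The action is reversible, so a shared element links the two representatives in both directions.
  common⇒≈ : ∀ {x} (s t : Rep) → cyclotomicCoset a n (proj₁ s) x →
    cyclotomicCoset a n (proj₁ t) x → s ≈ t
  common⇒≈ {x} (s , _ , s<n) (t , _ , t<n) x∈s x∈t =
    (λ {y} y∈s → coset-trans y s t y∈s (coset-trans s x t (coset-sym s<n x∈s) x∈t)) ,
    (λ {y} y∈t → coset-trans y t s y∈t (coset-trans t x s (coset-sym t<n x∈t) x∈s))

  orbit : Rep → List ℕ
  orbit (s , _) = applyUpTo (act s) h

  ∈orbit⁺ : ∀ s {x} → cyclotomicCoset a n (proj₁ s) x → x ∈ orbit s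
  ∈orbit⁺ (s , _) (j , refl) =
    subst (_∈ applyUpTo (act s) h) (sym (act-mod s j)) (∈-applyUpTo⁺ (act s) (m%n<n j h))

  ∈orbit⁻ : ∀ s {x} → x ∈ orbit s → cyclotomicCoset a n (proj₁ s) x
  ∈orbit⁻ (s , _) x∈ with ∈-applyUpTo⁻ (act s) x∈
  ... | j , _ , eq = j , eq

  orbit-unique : ∀ s → Unique (orbit s)
  orbit-unique (s , 1≤s , s<n) = applyUpTo⁺₁ (act s) h (act-distinct s 1≤s s<n)

  infix 4 _≈?_
  -- Cosets are equal as soon as one contains the other's representative, and that is a search in a
  -- finite orbit.
  _≈?_ : Decidable _≈_
  s@(_ , _ , s<n) ≈? t = map′
    (λ s∈t → common⇒≈ s t (coset-self s<n) (∈orbit⁻ t s∈t))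
    (λ s≈t → ∈orbit⁺ t (proj₁ s≈t (coset-self s<n)))
    (_∈?_ _≟_ (proj₁ s) (orbit t))

  cosetDecSetoid : DecSetoid 0ℓ 0ℓ
  cosetDecSetoid = record { isDecEquivalence = record { isEquivalence = ≈-isEquivalence ; _≟_ = _≈?_ } }

  -- One representative for each coset.

  rep : Fin (pred n) → Rep
  rep i = suc (toℕ i) , s≤s z≤n , subst (suc (toℕ i) <_) (suc-pred n) (s≤s (toℕ<n i))

  -- Deduplication compares cosets, not residues, so one representative survives from each coset.
  reps : List Rep
  reps = deduplicate _≈?_ (tabulate rep)

  reps-unique : SetoidUnique.Unique (cyclotomicCosets a n) reps
  reps-unique = deduplicate-! cosetDecSetoid (tabulate rep)

  reps-complete : ∀ s → Any (s ≈_) reps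
  reps-complete s@(suc s′ , _ , s<n) = ∈-deduplicate⁺ (cyclotomicCosets a n) _≈?_
    (λ {x} {y} {z} z≈y x≈y → ≈-trans {x} {y} {z} x≈y (≈-sym {z} {y} z≈y))
    {xs = tabulate rep} {z = s}
    -- `rep i` carries its own bound proofs and agrees with `s` only in its residue, so the two are
    -- compared through that common element.
    (tabulate⁺ i (common⇒≈ s (rep i) (coset-self s<n) (0 , eq)))
    where
    s′<pred : s′ < pred n
    s′<pred = s≤s⁻¹ (subst (suc s′ <_) (sym (suc-pred n)) s<n)
    i = fromℕ< s′<pred
    eq : suc s′ ≡ act (suc (toℕ i)) 0
    eq = subst (λ u → suc s′ ≡ act (suc u) 0) (sym (toℕ-fromℕ< s′<pred)) (proj₂ (coset-self s<n))

  r : ℕ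
  r = length reps

  r-count : IsCyclotomicCosetCount a n r
  r-count = record
    { to        = lookup reps
    ; cong      = λ { {i} refl → ≈-refl {lookup reps i} }
    ; bijective = lookup-injective (cyclotomicCosets a n) reps-unique
                , λ s → index (reps-complete s)
                , λ { refl → ≈-sym {s} {lookup reps (index (reps-complete s))} (lookup-index (reps-complete s)) }
    }

  -- Counting the nonzero residues by orbits.

  nonzero : List ℕ
  nonzero = applyUpTo suc (pred n)

  nonzero-unique : Unique nonzero
  nonzero-unique = applyUpTo⁺₁ suc (pred n) (λ i<j _ → <⇒≢ (s≤s i<j))

  orbit-disjoint : ∀ {s t} → ¬ s ≈ t → Disjoint (orbit s) (orbit t)
  orbit-disjoint {s} {t} s≉t (x∈s , x∈t) = s≉t (common⇒≈ s t (∈orbit⁻ s x∈s) (∈orbit⁻ t x∈t))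

  -- Freeness excludes repetitions within an orbit, and disjointness excludes them between orbits.
  orbits-unique : Unique (concatMap orbit reps)
  orbits-unique = concat⁺ (All.map⁺ (All.universal orbit-unique reps))
    (AllPairs.map⁺ (AllPairs.map (λ {s} {t} → orbit-disjoint {s} {t}) reps-unique))

  orbits⊆nonzero : ∀ {x} → x ∈ concatMap orbit reps → x ∈ nonzero
  orbits⊆nonzero x∈ with satisfied (∈-concatMap⁻ orbit {xs = reps} x∈)
  ... | s@(s′ , 1≤s , s<n) , x∈s with ∈orbit⁻ s x∈s
  ... | j , refl = in-range (1≤act s′ j 1≤s s<n) (act< s′ j)
    where
    in-range : ∀ {x} → 1 ≤ x → x < n → x ∈ nonzero
    in-range {suc x} _ x<n = ∈-applyUpTo⁺ suc (s≤s⁻¹ (subst (suc x <_) (sym (suc-pred n)) x<n))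

  nonzero⊆orbits : ∀ {x} → x ∈ nonzero → x ∈ concatMap orbit reps
  nonzero⊆orbits x∈ with ∈-applyUpTo⁻ suc x∈
  ... | i , i<pred , refl = ∈-concatMap⁺ orbit
    (Any.map (λ {t} s≈t → ∈orbit⁺ t (proj₁ s≈t (coset-self s<n))) (reps-complete (suc i , s≤s z≤n , s<n)))
    where
    s<n : suc i < n
    s<n = subst (suc i <_) (suc-pred n) (s≤s i<pred)

  -- Two duplicate-free lists with the same members are permutations of each other.
  orbits-length : length (concatMap orbit reps) ≡ length nonzero
  orbits-length = ↭-length (∼bag⇒↭ (unique∧set⇒bag orbits-unique nonzero-unique
    (mk⇔ orbits⊆nonzero nonzero⊆orbits)))

  n≡rh+1 : n ≡ r * h + 1
  n≡rh+1 = begin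
    n                                ≡⟨ suc-pred n ⟨
    suc (pred n)                        ≡⟨ cong suc (length-applyUpTo suc (pred n)) ⟨
    suc (length nonzero)                ≡⟨ cong suc orbits-length ⟨
    suc (length (concatMap orbit reps)) ≡⟨ cong suc (length-concatMap orbit
                                             (λ s → length-applyUpTo (act (proj₁ s)) h) reps) ⟩
    suc (r * h)                      ≡⟨ +-comm 1 (r * h) ⟩
    r * h + 1                        ∎
    where open ≡-Reasoning

-- Odd multiples of powers of two.

even⊎odd : ∀ k → (∃[ q ] k ≡ 2 * q) ⊎ (∃[ q ] k ≡ 1 + 2 * q)
even⊎odd zero = inj₁ (0 , refl)
even⊎odd (suc k) with even⊎odd k
... | inj₁ (q , refl) = inj₂ (q , refl)
... | inj₂ (q , refl) = inj₁ (suc q , cong suc (sym (+-suc q (q + 0))))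

-- Write `k` as 2^v times an odd number. The bound on `k` gives v ≤ `i`, so 2^(i-v) serves as `j`.
-- The recursion strips one factor 2 at a time.
odd-multiple-of-2^ : ∀ i k → 0 < k → k < 2 ^ suc i →
  ∃[ j ] ∃[ t ] k * j ≡ 2 ^ i * (1 + 2 * t)
odd-multiple-of-2^ zero    1 _ _ = 1 , 0 , refl
odd-multiple-of-2^ zero    (suc (suc k)) _ (s≤s (s≤s ()))
odd-multiple-of-2^ (suc i) k 0<k k< with even⊎odd k
... | inj₂ (t , refl) = 2 ^ suc i , t , *-comm (1 + 2 * t) (2 ^ suc i)
... | inj₁ (suc q , refl) with odd-multiple-of-2^ i (suc q) (s≤s z≤n) (*-cancelˡ-< 2 (suc q) _ k<)
...   | j , t , eq = j , t , trans (*-assoc 2 (suc q) j) (trans (cong (2 *_) eq) (sym (*-assoc 2 (2 ^ i) (1 + 2 * t))))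

-- Application to Fermat numbers.

module Fermat (m : ℕ) where

  M N h : ℕ
  M = 2 ^ (2 ^ m)
  N = M + 1
  h = 2 ^ suc m

  instance
    M≢0 : NonZero M
    M≢0 = m^n≢0 2 (2 ^ m)
    h≢0 : NonZero h
    h≢0 = m^n≢0 2 (suc m)
    2^m≢0 : NonZero (2 ^ m)
    2^m≢0 = m^n≢0 2 m
    N≢0 : NonZero N
    N≢0 = ≢-nonZero (m+1+n≢0 M)

  open Congruence N

  2∣M : 2 ∣ M
  -- The exponent `2 ^ m` is positive, so one factor 2 splits off.
  2∣M = subst (λ e → 2 ∣ 2 ^ e) (suc-pred (2 ^ m)) (m∣m*n (2 ^ pred (2 ^ m)))

  coprime : Coprime 2 N
  coprime (d∣2 , d∣N) = ∣1⇒≡1 (∣m+n∣m⇒∣n d∣N (∣-trans d∣2 2∣M))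

  odd : 2 ∤ N
  odd 2∣N with ∣1⇒≡1 (∣m+n∣m⇒∣n 2∣N 2∣M)
  ... | ()

  M²≋1 : M ^ 2 ≋ 1
  M²≋1 = trans (cong (_% N) eq) ([m+kn]%n≡m%n 1 (pred M) N)
    where
    -- With p = M - 1 this is M² = 1 + (M - 1)(M + 1), written without subtraction.
    identity : ∀ p → (1 + p) * ((1 + p) * 1) ≡ 1 + p * ((1 + p) + 1)
    identity = solve-∀
    eq : M ^ 2 ≡ 1 + pred M * N
    eq = subst (λ u → u ^ 2 ≡ 1 + pred M * (u + 1)) (suc-pred M) (identity (pred M))

  2^h≋1 : 2 ^ h ≋ 1
  2^h≋1 = trans (cong (_% N) (trans (cong (2 ^_) (*-comm 2 (2 ^ m))) (sym (^-*-assoc 2 (2 ^ m) 2)))) M²≋1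

  M^odd≋M : ∀ t → M ^ (1 + 2 * t) ≋ M
  M^odd≋M t = *-identityʳ-≋ M (trans (cong (_% N) (sym (^-*-assoc M 2 t))) (1-^ M²≋1 t))

  -- As M ≡ -1, the hypothesis reads -s ≡ s.
  M-fixes⇒N∣ : ∀ s → s * M ≋ s → N ∣ s
  M-fixes⇒N∣ s sM≋s = coprime-divisor (Coprime.sym coprime) (m%n≡0⇒n∣m (2 * s) N (begin
    (2 * s) % N             ≡⟨ cong (_% N) (cong (s +_) (+-identityʳ s)) ⟩
    (s + s) % N             ≡⟨ %-distribˡ-+ s s N ⟩
    (s % N + s % N) % N     ≡⟨ cong (λ u → (u + s % N) % N) sM≋s ⟨
    ((s * M) % N + s % N) % N ≡⟨ %-distribˡ-+ (s * M) s N ⟨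
    (s * M + s) % N         ≡⟨ cong (λ u → (s * M + u) % N) (*-identityʳ s) ⟨
    (s * M + s * 1) % N     ≡⟨ cong (_% N) (*-distribˡ-+ s M 1) ⟨
    (s * N) % N             ≡⟨ n∣m⇒m%n≡0 (s * N) N (divides s refl) ⟩
    0                       ∎))
    where open ≡-Reasoning

  free : ∀ s k → 1 ≤ s → s < N → 0 < k → k < h → (s * 2 ^ k) % N ≢ s % N
  free s k 1≤s s<N 0<k k<h fixed with odd-multiple-of-2^ m k 0<k k<h
  -- Since `s` is fixed by `2 ^ k`, it is fixed by the `j`-th power, an odd power of `M` and hence
  -- congruent to `M`. Then `N` divides `s`, against 1 ≤ s < N.
  ... | j , t , kj≡ = n>0⇒n≢0 1≤s (trans (sym (m<n⇒m%n≡m s<N)) (n∣m⇒m%n≡0 s N (M-fixes⇒N∣ s (begin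
    (s * M) % N               ≡⟨ *-congˡ-≋ s (M^odd≋M t) ⟨
    (s * M ^ (1 + 2 * t)) % N ≡⟨ cong (λ u → (s * u) % N) power ⟨
    (s * (2 ^ k) ^ j) % N     ≡⟨ fixed-^ s (2 ^ k) fixed j ⟩
    s % N                     ∎))))
    where
    open ≡-Reasoning
    power : (2 ^ k) ^ j ≡ M ^ (1 + 2 * t)
    power = trans (^-*-assoc 2 k j) (trans (cong (2 ^_) kj≡) (sym (^-*-assoc 2 (2 ^ m) (1 + 2 * t))))

  1<N : 1 < N
  1<N = subst (1 <_) (+-comm 1 M) (s≤s (m^n>0 2 (2 ^ m)))

  h-order : IsMultiplicativeOrder 2 N h
  h-order = record
    { positive = m^n>0 2 (suc m)
    ; power≡1  = 2^h≋1
    ; minimal  = λ k 0<k 2^k≋1 → ≮⇒≥ λ k<h →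
        free 1 k ≤-refl 1<N 0<k k<h (trans (cong (_% N) (*-identityˡ (2 ^ k))) 2^k≋1)
    }

  -- The order and the coset count hold for every `N` of this form; the case split on primality only
  -- supplies compositeness.
  primover : Primover 2 N
  primover with prime? N
  ... | yes N-prime = 1<N , inj₁ N-prime
  ... | no  ¬prime  = 1<N , inj₂ (record
    { odd         = odd
    ; isComposite = ¬prime⇒composite {{n>1⇒nonTrivial 1<N}} ¬prime
    ; coprime     = coprime
    ; h-order     = h-order
    ; r-count     = Cosets.r-count
    ; n≡rh+1      = Cosets.n≡rh+1
    })
    where module Cosets = FreeAction 2 N h 2^h≋1 free

theorem4 : (n : ℕ) → 1 ≤ n → Primover 2 (fermat n)
theorem4 n _ = Fermat.primover (n ∸ 1)
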